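{- Let $G$, $H$ be two graphs with $\mathrm{CDC}(G)\simeq \mathrm{CDC}(H)$, and let $k$ be a natural number. Then, for an appropriate labelling of the vertices (i.e. after suitably relabelling the vertices of one of the graphs, equivalently, after permuting the rows of one of the matrices by a suitable permutation), $\mathbf W_G(k) = \mathbf W_H(k)$.
   Context: All graphs are finite, simple and undirected (no loops or multiple edges), with vertex set $\mathcal V=\{1,\dots,n\}$ and edge set $\mathcal E$. The adjacency matrix $\mathbf A=\mathbf A(G)$ is the symmetric $n\times n$ $(0,1)$-matrix with $(i,j)$ entry $1$ iff $\{i,j\}\in\mathcal E$. The canonical double covering $\mathrm{CDC}(G)$ of $G=(\mathcal V,\mathcal E)$ is the graph with vertex set $\mathcal V\times\{0,1\}$ and edge set $\{\{(u,0),(v,1)\},\{(u,1),(v,0)\} : \{u,v\}\in\mathcal E\}$. $\simeq$ denotes graph isomorphism. Let $\mathbf j=(1,\dots,1)^T$ be the all-ones column vector. The $k$-walk matrix $\mathbf W_G(k)$ is the $n\times k$ matrix whose columns are $\mathbf j,\mathbf A\mathbf j,\mathbf A^2\mathbf j,\dots,\mathbf A^{k-1}\mathbf j$. -}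

module Defs where

open import Data.Bool.Base using (if_then_else_)
open import Data.Fin.Base using (Fin; toℕ)
open import Data.Fin.Patterns using (0F; 1F)
open import Data.Fin.Properties using (_≟_)
open import Data.Nat.Base using (ℕ; zero; suc; _*_; +-0-rawMonoid)
open import Data.Product.Base using (_×_; _,_)
open import Data.Vec.Functional using (Vector)
open import Function.Bundles using (_↔_; _⇔_; Inverse)
open import Relation.Binary.Definitions using (Decidable; Irreflexive; Symmetric)
open import Relation.Binary.PropositionalEquality.Core using (_≡_; refl; cong)
open import Relation.Nullary.Decidable.Core using (does; yes; no)
open import Relation.Nullary.Decidable using (map′)
open import Algebra.Definitions.RawMonoid +-0-rawMonoid using (sum)

-- Simple undirected graphs. Only the truth of Adj u v is used: isomorphisms
-- and adjacency matrices do not see which proof of adjacency is given.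

record Graph (V : Set) : Set₁ where
  field
    Adj    : V → V → Set
    adj?   : Decidable Adj
    sym    : Symmetric Adj
    irrefl : Irreflexive _≡_ Adj

open Graph

infix 4 _≃_

record _≃_ {V W : Set} (G : Graph V) (H : Graph W) : Set where
  field
    bijection : V ↔ W
    preserves : ∀ u v → Adj G u v ⇔
                Adj H (Inverse.to bijection u) (Inverse.to bijection v)

-- Vertex v of the relabelled graph is vertex σ v of H.

relabel : {V W : Set} → V ↔ W → Graph W → Graph V
relabel σ H = record
  { Adj    = λ u v → Adj H (to u) (to v)
  ; adj?   = λ u v → adj? H (to u) (to v)
  ; sym    = sym H
  ; irrefl = λ u≡v → irrefl H (cong to u≡v)
  }
  where open Inverse σ using (to)

data CDCAdj {V : Set} (G : Graph V) : V × Fin 2 → V × Fin 2 → Set where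
  edge₀₁ : ∀ {u v} → Adj G u v → CDCAdj G (u , 0F) (v , 1F)
  edge₁₀ : ∀ {u v} → Adj G u v → CDCAdj G (u , 1F) (v , 0F)

CDC : {V : Set} → Graph V → Graph (V × Fin 2)
CDC G = record
  { Adj    = CDCAdj G
  ; adj?   = dec
  ; sym    = λ { (edge₀₁ e) → edge₁₀ (sym G e) ; (edge₁₀ e) → edge₀₁ (sym G e) }
  ; irrefl = λ { refl () }
  }
  where
  dec : Decidable (CDCAdj G)
  dec (u , 0F) (v , 0F) = no λ ()
  dec (u , 0F) (v , 1F) = map′ edge₀₁ (λ { (edge₀₁ e) → e }) (adj? G u v)
  dec (u , 1F) (v , 0F) = map′ edge₁₀ (λ { (edge₁₀ e) → e }) (adj? G u v)
  dec (u , 1F) (v , 1F) = no λ ()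

Matrix : ℕ → ℕ → Set
Matrix m n = Vector (Vector ℕ n) m

infixl 7 _∙_ _·_
infixr 8 _^_

_∙_ : ∀ {m n p} → Matrix m n → Matrix n p → Matrix m p
(A ∙ B) i j = sum λ l → A i l * B l j

_·_ : ∀ {m n} → Matrix m n → Vector ℕ n → Vector ℕ m
(A · x) i = sum λ l → A i l * x l

𝟙 : ∀ {n} → Matrix n n
𝟙 i j = if does (i ≟ j) then 1 else 0

_^_ : ∀ {n} → Matrix n n → ℕ → Matrix n n
A ^ zero  = 𝟙
A ^ suc c = A ∙ A ^ c

adjacencyMatrix : ∀ {n} → Graph (Fin n) → Matrix n n
adjacencyMatrix G i j = if does (adj? G i j) then 1 else 0

𝐣 : ∀ {n} → Vector ℕ n
𝐣 _ = 1

walkMatrix : ∀ {n} → Graph (Fin n) → (k : ℕ) → Matrix n k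
walkMatrix G k i c = (adjacencyMatrix G ^ toℕ c · 𝐣) i

{-# OPTIONS --safe #-}

-- Walks in CDC(G) from (v , b) of a given length biject with walks in G from v
-- of that length, so an isomorphism CDC(G) ≃ CDC(H) preserves the rows of the
-- walk matrices after projection to the first coordinate. Each row of
-- W_G(k) or W_H(k) arises from exactly two vertices of the cover, so twice the
-- multiset of rows is the same for both graphs, and hence so is the multiset.

module Submission where

open import Defs
import Algebra.Properties.Semiring.Sum
open import Data.Bool.Base using (if_then_else_)
open import Data.Fin.Base using (Fin; zero; suc; toℕ; remQuot)
open import Data.Fin.Patterns using (0F; 1F)
open import Data.Fin.Permutation as Perm using (Permutation; _⟨$⟩ʳ_; insert)
open import Data.Fin.Properties using (*↔×)
open import Data.Nat.Base using (ℕ; zero; suc; _+_; _*_; ⌊_/2⌋; +-0-rawMonoid)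
open import Data.Nat.Properties as ℕ using (+-*-semiring; *-assoc; +-assoc; +-identityʳ; +-cancelˡ-≡; n≡⌊n+n/2⌋)
open import Data.Product.Base as Product using (Σ-syntax; ∃-syntax; _×_; _,_; proj₁; proj₂)
open import Data.Vec.Base using (Vec; lookup; tabulate)
open import Data.Vec.Properties using (lookup∘tabulate; tabulate-cong; ≡-dec)
open import Data.Vec.Functional using (Vector; head; tail; removeAt)
open import Function.Base using (id; _∘_)
open import Function.Bundles using (_↔_; _⇔_; Inverse)
open import Function.Construct.Composition using (_↔-∘_)
open import Function.Construct.Identity using (⇔-id)
open import Function.Construct.Symmetry using (↔-sym)
open import Relation.Binary.Definitions using (DecidableEquality)
open import Relation.Binary.PropositionalEquality
open import Relation.Nullary.Decidable using (does; yes; no; dec-true; does-⇔)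
open import Relation.Nullary.Negation using (contradiction)
open import Algebra.Definitions.RawMonoid +-0-rawMonoid using (sum)

open ≡-Reasoning

private
  module ∑ = Algebra.Properties.Semiring.Sum +-*-semiring

  variable
    m n p : ℕ

-- `remQuot` lists the pairs so that the two layers over each vertex are consecutive; the induction
-- peels off one such pair at a time.
sum-remQuot : ∀ m (t : Fin m × Fin 2 → ℕ) →
              sum (t ∘ remQuot {m} 2) ≡ sum λ u → t (u , 0F) + t (u , 1F)
sum-remQuot zero    t = refl
sum-remQuot (suc m) t = begin
  t (0F , 0F) + (t (0F , 1F) + sum (t′ ∘ remQuot {m} 2))              ≡⟨ +-assoc (t (0F , 0F)) _ _ ⟨
  t (0F , 0F) + t (0F , 1F) + sum (t′ ∘ remQuot {m} 2)                ≡⟨ cong (t (0F , 0F) + t (0F , 1F) +_) (sum-remQuot m t′) ⟩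
  t (0F , 0F) + t (0F , 1F) + sum (λ u → t′ (u , 0F) + t′ (u , 1F))  ∎
  where
  t′ = t ∘ Product.map₁ suc

∙-·-assoc : ∀ (A : Matrix m n) (B : Matrix n p) x i → ((A ∙ B) · x) i ≡ (A · (B · x)) i
∙-·-assoc A B x i = begin
  sum (λ l → sum (λ h → A i h * B h l) * x l)    ≡⟨ ∑.sum-cong-≗ (λ l → ∑.*-distribʳ-sum (x l) (λ h → A i h * B h l)) ⟩
  sum (λ l → sum λ h → A i h * B h l * x l)      ≡⟨ ∑.∑-comm (λ l h → A i h * B h l * x l) ⟩
  sum (λ h → sum λ l → A i h * B h l * x l)      ≡⟨ ∑.sum-cong-≗ (λ h → ∑.sum-cong-≗ λ l → *-assoc (A i h) (B h l) (x l)) ⟩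
  sum (λ h → sum λ l → A i h * (B h l * x l))    ≡⟨ ∑.sum-cong-≗ (λ h → ∑.*-distribˡ-sum (A i h) (λ l → B h l * x l)) ⟨
  sum (λ h → A i h * sum λ l → B h l * x l)      ∎

𝟙·𝐣 : ∀ (i : Fin n) → (𝟙 · 𝐣) i ≡ 1
𝟙·𝐣 {suc n} 0F      = cong suc (trans (∑.sum-cong-≗ {n} λ _ → refl) (∑.sum-replicate-zero n))
𝟙·𝐣 {suc n} (suc i) = 𝟙·𝐣 i

-- Entry `v` is the number of walks of length `c` starting at `v`, which is column `c` of the walk
-- matrix.
walks : Graph (Fin n) → ℕ → Vector ℕ n
walks G c = adjacencyMatrix G ^ c · 𝐣

walks-suc : ∀ (G : Graph (Fin n)) c v → walks G (suc c) v ≡ (adjacencyMatrix G · walks G c) v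
walks-suc G c = ∙-·-assoc A (A ^ c) 𝐣
  where A = adjacencyMatrix G

-- An isomorphism carries the neighbours of `v` to those of its image, so the recursion over the
-- first step of a walk is only reindexed.
walks-≃ : ∀ {G : Graph (Fin m)} {H : Graph (Fin n)} (iso : G ≃ H) c v →
          walks G c v ≡ walks H c (_≃_.bijection iso ⟨$⟩ʳ v)
walks-≃ iso zero v = trans (𝟙·𝐣 v) (sym (𝟙·𝐣 (_≃_.bijection iso ⟨$⟩ʳ v)))
walks-≃ {G = G} {H} iso (suc c) v = begin
  walks G (suc c) v                                               ≡⟨ walks-suc G c v ⟩
  sum (λ u → adjacencyMatrix G v u * walks G c u)                 ≡⟨ ∑.sum-cong-≗ (λ u → cong₂ _*_ (adjacent u) (walks-≃ iso c u)) ⟩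
  sum (λ u → adjacencyMatrix H (φ v) (φ u) * walks H c (φ u))     ≡⟨ ∑.sum-permute (λ u → adjacencyMatrix H (φ v) u * walks H c u) bijection ⟨
  sum (λ u → adjacencyMatrix H (φ v) u * walks H c u)             ≡⟨ walks-suc H c (φ v) ⟨
  walks H (suc c) (φ v)                                           ∎
  where
  open _≃_ iso
  φ = bijection ⟨$⟩ʳ_
  adjacent : ∀ u → adjacencyMatrix G v u ≡ adjacencyMatrix H (φ v) (φ u)
  adjacent u = cong (if_then 1 else 0)
    (does-⇔ (preserves v u) (Graph.adj? G v u) (Graph.adj? H (φ v) (φ u)))

relabel-≃ : ∀ {V W : Set} (σ : V ↔ W) (H : Graph W) → relabel σ H ≃ H
relabel-≃ σ H = record { bijection = σ ; preserves = λ u v → ⇔-id _ }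

relabel-cong : ∀ {V V′ W W′ : Set} {G : Graph W} {H : Graph W′} (σ : V ↔ W) (τ : V′ ↔ W′) →
               G ≃ H → relabel σ G ≃ relabel τ H
relabel-cong {H = H} σ τ iso = record
  { bijection = ↔-sym τ ↔-∘ (bijection ↔-∘ σ)
  -- Adjacency in `relabel τ H` applies `τ` to its arguments, which undoes the inverse of `τ` at the
  -- end of the bijection.
  ; preserves = λ u v → subst₂ (λ x y → _ ⇔ Graph.Adj H x y)
      (sym (Inverse.strictlyInverseˡ τ _)) (sym (Inverse.strictlyInverseˡ τ _))
      (preserves (Inverse.to σ u) (Inverse.to σ v))
  }
  where
  open _≃_ iso

-- The cover is moved onto `Fin (n * 2)` because adjacency matrices are indexed by `Fin`.
FinCDC : Graph (Fin n) → Graph (Fin (n * 2))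
FinCDC G = relabel *↔× (CDC G)

base : Fin (n * 2) → Fin n
base {n} i = proj₁ (remQuot {n} 2 i)

-- Over each neighbour of `base i`, the vertex `i` has exactly one neighbour, in the opposite layer;
-- by induction on the length, the walk counts agree.
walks-FinCDC : ∀ (G : Graph (Fin n)) c i → walks (FinCDC G) c i ≡ walks G c (base i)
walks-FinCDC {n} G zero    i = trans (𝟙·𝐣 i) (sym (𝟙·𝐣 (base {n} i)))
walks-FinCDC {n} G (suc c) i = begin
  walks (FinCDC G) (suc c) i
    ≡⟨ walks-suc (FinCDC G) c i ⟩
  sum (λ h → adjacencyMatrix (FinCDC G) i h * walks (FinCDC G) c h)
    ≡⟨ ∑.sum-cong-≗ (λ h → cong (adjacencyMatrix (FinCDC G) i h *_) (walks-FinCDC G c h)) ⟩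
  sum (λ h → adjacencyMatrix (FinCDC G) i h * walks G c (base h))
    ≡⟨ sum-remQuot n (t (remQuot {n} 2 i)) ⟩
  sum (λ u → t (remQuot {n} 2 i) (u , 0F) + t (remQuot {n} 2 i) (u , 1F))
    ≡⟨ ∑.sum-cong-≗ (step (remQuot {n} 2 i)) ⟩
  sum (λ u → adjacencyMatrix G (base i) u * walks G c u)
    ≡⟨ walks-suc G c (base {n} i) ⟨
  walks G (suc c) (base i)
    ∎
  where
  t : Fin n × Fin 2 → Fin n × Fin 2 → ℕ
  t x y = (if does (Graph.adj? (CDC G) x y) then 1 else 0) * walks G c (proj₁ y)

  -- Generalised from `remQuot` to any `x` so that its layer can be matched on; the term for `u` in
  -- the same layer computes to 0.
  step : ∀ x u → t x (u , 0F) + t x (u , 1F) ≡ adjacencyMatrix G (proj₁ x) u * walks G c u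
  step (v , 0F) u = refl
  step (v , 1F) u = +-identityʳ _

module _ {K : Set} (_≟_ : DecidableEquality K) where

  count : Vector K n → K → ℕ
  count f x = sum λ i → if does (f i ≟ x) then 1 else 0

  count-head≢0 : ∀ (f : Vector K (suc n)) → count f (head f) ≢ 0
  count-head≢0 f rewrite dec-true (head f ≟ head f) refl = λ ()

  count≢0⇒∃ : ∀ (f : Vector K n) x → count f x ≢ 0 → ∃[ j ] f j ≡ x
  count≢0⇒∃ {zero}  f x ≢0 = contradiction refl ≢0
  count≢0⇒∃ {suc n} f x ≢0 with head f ≟ x
  ... | yes f₀≡x = 0F , f₀≡x
  ... | no  _    = Product.map suc id (count≢0⇒∃ (tail f) x ≢0)

  count-permute : ∀ (f : Vector K m) (g : Vector K n) (π : Permutation m n) →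
                  f ≗ g ∘ (π ⟨$⟩ʳ_) → count f ≗ count g
  count-permute f g π f≗g∘π x = begin
    count f x                 ≡⟨ ∑.sum-cong-≗ (λ i → cong (λ y → if does (y ≟ x) then 1 else 0) (f≗g∘π i)) ⟩
    count (g ∘ (π ⟨$⟩ʳ_)) x   ≡⟨ ∑.sum-permute (λ i → if does (g i ≟ x) then 1 else 0) π ⟨
    count g x                 ∎

  count-base : ∀ (f : Vector K n) x → count (f ∘ base) x ≡ count f x + count f x
  count-base {n} f x = trans (sum-remQuot n (indicator ∘ proj₁)) (∑.∑-distrib-+ indicator indicator)
    where
    indicator : Vector ℕ n
    indicator i = if does (f i ≟ x) then 1 else 0

  -- Every value is counted twice in the cover, and doubling can be undone by halving.
  count-base-injective : ∀ (f : Vector K m) (g : Vector K n) →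
                         count (f ∘ base) ≗ count (g ∘ base) → count f ≗ count g
  count-base-injective f g eq x = begin
    count f x                        ≡⟨ n≡⌊n+n/2⌋ (count f x) ⟩
    ⌊ count f x + count f x /2⌋      ≡⟨ cong ⌊_/2⌋ (trans (sym (count-base f x)) (trans (eq x) (count-base g x))) ⟩
    ⌊ count g x + count g x /2⌋      ≡⟨ n≡⌊n+n/2⌋ (count g x) ⟨
    count g x                        ∎

  -- Greedy matching: pair the head of `f` with an equal entry of `g`, delete both, and recurse on
  -- counts that still agree. That `m` and `n` coincide is a result of the recursion.
  count-≗⇒permutation : ∀ (f : Vector K m) (g : Vector K n) → count f ≗ count g →
                        Σ[ σ ∈ Permutation m n ] f ≗ g ∘ (σ ⟨$⟩ʳ_)
  count-≗⇒permutation {zero}  {zero}  f g eq = Perm.id , λ ()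
  count-≗⇒permutation {zero}  {suc n} f g eq = contradiction (sym (eq (head g))) (count-head≢0 g)
  count-≗⇒permutation {suc m} {n}     f g eq
    with count≢0⇒∃ g (head f) (count-head≢0 f ∘ trans (eq (head f)))
  -- An empty `g` is excluded here, since `j` would lie in `Fin 0`.
  count-≗⇒permutation {suc m} {suc n} f g eq | j , gⱼ≡f₀
    with count-≗⇒permutation (tail f) (removeAt g j) tail-eq
    where
    tail-eq : count (tail f) ≗ count (removeAt g j)
    tail-eq x = +-cancelˡ-≡ (if does (head f ≟ x) then 1 else 0) _ _ (begin
      count f x                                                            ≡⟨ eq x ⟩
      count g x                                                            ≡⟨ ∑.sum-remove {i = j} (λ i → if does (g i ≟ x) then 1 else 0) ⟩
      (if does (g j ≟ x) then 1 else 0) + count (removeAt g j) x           ≡⟨ cong (λ y → (if does (y ≟ x) then 1 else 0) + count (removeAt g j) x) gⱼ≡f₀ ⟩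
      (if does (head f ≟ x) then 1 else 0) + count (removeAt g j) x        ∎)
  -- `insert 0F j σ` sends 0 to `j` and the other indices through `σ`, skipping over `j` just as
  -- `removeAt g j` does.
  ... | σ , f≗g∘σ = insert 0F j σ , λ { 0F → sym gⱼ≡f₀ ; (suc i) → f≗g∘σ i }

-- Rows are stored as `Vec` rather than as functions, so that equality of rows is decidable and they
-- can be counted.
walkRow : Graph (Fin n) → (k : ℕ) → Fin n → Vec ℕ k
walkRow G k v = tabulate (walkMatrix G k v)

theorem3p3 : ∀ {m n : ℕ} (G : Graph (Fin m)) (H : Graph (Fin n)) → CDC G ≃ CDC H → (k : ℕ) →
    Σ[ σ ∈ Permutation m n ] (∀ i c → walkMatrix G k i c ≡ walkMatrix (relabel σ H) k i c)
theorem3p3 {m} {n} G H iso k = σ , λ i c → begin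
  walkMatrix G k i c                            ≡⟨ lookup∘tabulate (walkMatrix G k i) c ⟨
  lookup (walkRow G k i) c                      ≡⟨ cong (λ r → lookup r c) (rows≗ i) ⟩
  lookup (walkRow H k (σ ⟨$⟩ʳ i)) c             ≡⟨ lookup∘tabulate (walkMatrix H k (σ ⟨$⟩ʳ i)) c ⟩
  walkMatrix H k (σ ⟨$⟩ʳ i) c                   ≡⟨ walks-≃ (relabel-≃ σ H) (toℕ c) i ⟨
  walkMatrix (relabel σ H) k i c                ∎
  where
  iso′ : FinCDC G ≃ FinCDC H
  iso′ = relabel-cong *↔× *↔× iso

  π : Permutation (m * 2) (n * 2)
  π = _≃_.bijection iso′

  base-rows : ∀ i → walkRow G k (base i) ≡ walkRow H k (base (π ⟨$⟩ʳ i))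
  base-rows i = tabulate-cong λ c → begin
    walks G (toℕ c) (base i)                ≡⟨ walks-FinCDC G (toℕ c) i ⟨
    walks (FinCDC G) (toℕ c) i              ≡⟨ walks-≃ iso′ (toℕ c) i ⟩
    walks (FinCDC H) (toℕ c) (π ⟨$⟩ʳ i)     ≡⟨ walks-FinCDC H (toℕ c) (π ⟨$⟩ʳ i) ⟩
    walks H (toℕ c) (base (π ⟨$⟩ʳ i))       ∎

  -- `π` may send the two vertices over `v` to different fibres, so it need not induce a map of base
  -- vertices; `σ` is obtained from the multiplicities of the rows instead.
  matching : Σ[ σ ∈ Permutation m n ] walkRow G k ≗ walkRow H k ∘ (σ ⟨$⟩ʳ_)
  matching = count-≗⇒permutation (≡-dec ℕ._≟_) (walkRow G k) (walkRow H k)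
    (count-base-injective (≡-dec ℕ._≟_) (walkRow G k) (walkRow H k)
      (count-permute (≡-dec ℕ._≟_) (walkRow G k ∘ base) (walkRow H k ∘ base) π base-rows))

  σ = proj₁ matching
  rows≗ = proj₂ matching
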